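{- For integers $r\ge 2$ and $k\ge r-1$, $\chi_l(K_{(r+1)*(r-1),r*(k-r+1)}^r)=k$.
   Context: All hypergraphs are finite. A vertex coloring of a hypergraph is proper if no edge is monochromatic. A $k$-list assignment $L$ assigns to each vertex $v$ a set $L(v)$ of exactly $k$ colors; an $L$-coloring is a proper coloring with each vertex $v$ colored from $L(v)$; $\chi_l(H)$ is the least $k$ such that $H$ is $L$-colorable for every $k$-list assignment $L$. For positive integers $p_1,\dots,p_k$ and disjoint sets $V_1,\dots,V_k$ with $|V_i|=p_i$, the hypergraph $K^r_{p_1,\dots,p_k}$ has vertex set $V_1\cup\cdots\cup V_k$ and edge set consisting of all $r$-subsets $S$ of the vertex set with $S\not\subseteq V_i$ for every $i$. $K_{(r+1)*(r-1),r*(k-r+1)}^r$ denotes this hypergraph with $r-1$ parts of size $r+1$ and $k-r+1$ parts of size $r$ (so $k$ parts in total). -}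

module Defs where

open import Level using (0ℓ)
open import Data.Nat using (ℕ; _<_; _≤_; _∸_; suc)
open import Data.Nat.Properties using (_<?_)
open import Data.Fin using (Fin; toℕ)
open import Data.Product using (Σ; ∃; _×_; proj₁)
open import Data.List using (List; length)
open import Data.List.Relation.Unary.All using (All)
open import Data.List.Relation.Unary.Unique.Propositional using (Unique)
open import Data.List.Membership.Propositional using (_∈_)
open import Relation.Nullary using (¬_; yes; no)
open import Relation.Binary.PropositionalEquality using (_≡_)

-- A hypergraph: a vertex type and a predicate saying which (duplicate-free)
-- lists of vertices form edges (an edge is the set of its list entries).
record Hypergraph : Set₁ where
  field
    V    : Set
    Edge : List V → Set
open Hypergraph public

Monochromatic : {V : Set} → (V → ℕ) → List V → Set
Monochromatic c e = ∃ λ col → All (λ v → c v ≡ col) e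

Proper : (H : Hypergraph) → (V H → ℕ) → Set
Proper H c = ∀ e → Edge H e → ¬ Monochromatic c e

IsListAssignment : (H : Hypergraph) → ℕ → (V H → List ℕ) → Set
IsListAssignment H k L = ∀ v → length (L v) ≡ k × Unique (L v)

LColourable : (H : Hypergraph) → (V H → List ℕ) → Set
LColourable H L = Σ (V H → ℕ) λ c → (∀ v → c v ∈ L v) × Proper H c

Choosable : Hypergraph → ℕ → Set
Choosable H k = ∀ L → IsListAssignment H k L → LColourable H L

ListChromaticNumberIs : Hypergraph → ℕ → Set
ListChromaticNumberIs H k = Choosable H k × (∀ m → m < k → ¬ Choosable H m)

CompleteMultipartite : (r k : ℕ) → (Fin k → ℕ) → Hypergraph
CompleteMultipartite r k p = record
  { V    = Σ (Fin k) (λ i → Fin (p i))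
  ; Edge = λ e → length e ≡ r × Unique e
                 × ¬ (∃ λ i → All (λ v → proj₁ v ≡ i) e)
  }

partSizes : (r k : ℕ) → Fin k → ℕ
partSizes r k i with toℕ i <? r ∸ 1
... | yes _ = suc r
... | no  _ = r

K : (r k : ℕ) → Hypergraph
K r k = CompleteMultipartite r k (partSizes r k)

{-# OPTIONS --safe #-}
module Submission where

-- Lower bound: a colour class with at least r vertices lies inside one part, so it can be deleted together with that
-- part; once all classes have fewer than r vertices, fewer colours than parts do not suffice, each part having r vertices.
--
-- Choosability, with m = r - 1.  If some part has a colour common to all its vertices, give it that colour and delete both.
-- Otherwise, while some colour occurs on at least r vertices of a part (necessarily a part of size r + 1 with one vertex
-- left out), give them that colour, delete it, and set the exceptional vertex, whose list keeps its full size, aside in Z.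
-- Then every colour occurs at most m times in each remaining part, and Hall's theorem with capacity m per colour applies:
-- with t parts remaining, j = |Z| and N colours available on S, a set S with m N < |S| is impossible because
--   * if S contains a whole part, the largest of size p, then |S| ≤ p t + j ≤ m N, as a deleted colour occurred at most
--     p - 1 times in that part;
--   * otherwise, if S contains r vertices of a part or meets Z, then N ≥ t + 1, while |S| ≤ m t + m as at most m parts are large;
--   * in the remaining case |S| ≤ m t and N ≥ t.

open import Defs
open import Data.Nat using (ℕ; zero; suc; _+_; _*_; _∸_; _≤_; _<_; z≤n; s≤s; s≤s⁻¹; _≟_; _≤?_; _<?_)
open import Data.Nat.Properties
open import Data.Nat.ListAction using (sum)
open import Data.Nat.ListAction.Properties using (sum-++; sum-↭)
open import Data.Nat.Tactic.RingSolver using (solve-∀)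
open import Data.Product using (Σ; ∃; _×_; _,_; proj₁; proj₂)
open import Data.Sum using (_⊎_; inj₁; inj₂)
open import Data.Product.Properties using (≡-dec)
open import Data.Fin using (Fin; toℕ)
import Data.Fin as Fin
import Data.Fin.Properties as Fin
open import Data.List using (List; []; _∷_; _++_; map; length; filter; concatMap; take; allFin; upTo; deduplicate)
open import Data.List.Properties using (map-++; filter-notAll; length-map; length-tabulate; length-upTo; length-take)
open import Data.List.Relation.Unary.All using (All; []; _∷_; all?)
import Data.List.Relation.Unary.All as All
import Data.List.Relation.Unary.All.Properties as All
open import Data.List.Relation.Unary.All.Properties using (¬Any⇒All¬; ¬All⇒Any¬)
open import Data.List.Relation.Unary.Any using (Any; here; there; any?)
open import Data.List.Relation.Unary.AllPairs using ([]; _∷_)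
open import Data.List.Relation.Unary.Unique.Propositional using (Unique)
open import Data.List.Relation.Unary.Unique.Propositional.Properties using (Unique[x∷xs]⇒x∉xs; filter⁺; map⁺; ++⁺; take⁺; allFin⁺; upTo⁺)
open import Data.List.Relation.Unary.Unique.DecPropositional.Properties using (deduplicate-!)
open import Data.List.Membership.Propositional using (_∈_; _∉_; find; lose)
open import Data.List.Membership.Propositional.Properties using (∈-∃++; ∈-length; ∈-filter⁺; ∈-filter⁻; ∈-map⁺; ∈-map⁻; ∈-++⁺ˡ; ∈-++⁺ʳ; ∈-++⁻; ∈-concatMap⁺; ∈-concatMap⁻; ∈-allFin; ∈-upTo⁺; ∈-deduplicate⁺)
open import Data.List.Membership.DecPropositional _≟_ using (_∈?_)
open import Data.List.Relation.Binary.Permutation.Propositional using (_↭_; prep; ↭-sym; ↭⇒↭ₛ)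
open import Data.List.Relation.Binary.Permutation.Propositional.Properties using (shift; ↭-length; ∈-resp-↭) renaming (map⁺ to ↭-map⁺)
import Data.List.Relation.Binary.Permutation.Setoid.Properties as Permₛ
open import Function using (_∘_; id; case_of_)
open import Relation.Nullary using (¬_; Dec; yes; no; contradiction)
open import Relation.Nullary.Decidable using (_×-dec_; ¬?)
open import Relation.Unary using (Decidable)
open import Relation.Binary.Definitions using (DecidableEquality)
open import Relation.Binary.PropositionalEquality

-- Finite sums and counting

∑ : {A : Set} → List A → (A → ℕ) → ℕ
∑ xs f = sum (map f xs)

module _ {A : Set} where

  ∑-↭ : ∀ {xs ys : List A} → xs ↭ ys → ∀ f → ∑ xs f ≡ ∑ ys f
  ∑-↭ p f = sum-↭ (↭-map⁺ f p)

  ∑-++ : ∀ (xs ys : List A) f → ∑ (xs ++ ys) f ≡ ∑ xs f + ∑ ys f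
  ∑-++ xs ys f = trans (cong sum (map-++ f xs ys)) (sum-++ (map f xs) (map f ys))

  ∑-mono : ∀ (xs : List A) {f g} → (∀ {x} → x ∈ xs → f x ≤ g x) → ∑ xs f ≤ ∑ xs g
  ∑-mono []       f≤g = z≤n
  ∑-mono (x ∷ xs) f≤g = +-mono-≤ (f≤g (here refl)) (∑-mono xs (f≤g ∘ there))

  ∑-cong : ∀ (xs : List A) {f g} → (∀ {x} → x ∈ xs → f x ≡ g x) → ∑ xs f ≡ ∑ xs g
  ∑-cong xs f≡g = ≤-antisym (∑-mono xs (≤-reflexive ∘ f≡g)) (∑-mono xs (≤-reflexive ∘ sym ∘ f≡g))

  ∑-zero : ∀ (xs : List A) → ∑ xs (λ _ → 0) ≡ 0
  ∑-zero []       = refl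
  ∑-zero (_ ∷ xs) = ∑-zero xs

  ∑-+ : ∀ (xs : List A) f g → ∑ xs (λ x → f x + g x) ≡ ∑ xs f + ∑ xs g
  ∑-+ []       f g = refl
  ∑-+ (x ∷ xs) f g = trans (cong ((f x + g x) +_) (∑-+ xs f g)) (interchange (f x) (g x) (∑ xs f) (∑ xs g))
    where
    interchange : ∀ a b c d → (a + b) + (c + d) ≡ (a + c) + (b + d)
    interchange = solve-∀

  ∑-*ˡ : ∀ (xs : List A) a f → ∑ xs (λ x → a * f x) ≡ a * ∑ xs f
  ∑-*ˡ []       a f = sym (*-zeroʳ a)
  ∑-*ˡ (x ∷ xs) a f = trans (cong (a * f x +_) (∑-*ˡ xs a f)) (sym (*-distribˡ-+ a (f x) (∑ xs f)))

  ∑-const : ∀ (xs : List A) a → ∑ xs (λ _ → a) ≡ length xs * a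
  ∑-const []       a = refl
  ∑-const (x ∷ xs) a = cong (a +_) (∑-const xs a)

  ∑-term : ∀ {x} {xs : List A} → x ∈ xs → ∀ f → f x ≤ ∑ xs f
  ∑-term (here refl) f = m≤m+n _ _
  ∑-term (there x∈)  f = ≤-trans (∑-term x∈ f) (m≤n+m _ _)

∑-swap : ∀ {A B : Set} (xs : List A) (ys : List B) (f : A → B → ℕ) →
         ∑ xs (λ x → ∑ ys (f x)) ≡ ∑ ys (λ y → ∑ xs (λ x → f x y))
∑-swap []       ys f = sym (∑-zero ys)
∑-swap (x ∷ xs) ys f = trans (cong (∑ ys (f x) +_) (∑-swap xs ys f)) (sym (∑-+ ys (f x) _))

∑-concatMap : ∀ {A B : Set} (xs : List A) (g : A → List B) f →
              ∑ (concatMap g xs) f ≡ ∑ xs (λ x → ∑ (g x) f)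
∑-concatMap []       g f = refl
∑-concatMap (x ∷ xs) g f = trans (∑-++ (g x) (concatMap g xs) f) (cong (∑ (g x) f +_) (∑-concatMap xs g f))

𝟙 : {P : Set} → Dec P → ℕ
𝟙 (yes _) = 1
𝟙 (no _)  = 0

𝟙≤1 : ∀ {P : Set} (P? : Dec P) → 𝟙 P? ≤ 1
𝟙≤1 (yes _) = ≤-refl
𝟙≤1 (no _)  = z≤n

𝟙-mono : ∀ {P Q : Set} (P? : Dec P) (Q? : Dec Q) → (P → Q) → 𝟙 P? ≤ 𝟙 Q?
𝟙-mono (no _)  _       _   = z≤n
𝟙-mono (yes _) (yes _) _   = ≤-refl
𝟙-mono (yes p) (no ¬q) p→q = contradiction (p→q p) ¬q

𝟙-yes : ∀ {P : Set} (P? : Dec P) → P → 𝟙 P? ≡ 1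
𝟙-yes (yes _) _ = refl
𝟙-yes (no ¬p) p = contradiction p ¬p

𝟙-no : ∀ {P : Set} (P? : Dec P) → ¬ P → 𝟙 P? ≡ 0
𝟙-no (yes p) ¬p = contradiction p ¬p
𝟙-no (no _)  _  = refl

count : {A : Set} {P : A → Set} → Decidable P → List A → ℕ
count P? xs = ∑ xs (λ x → 𝟙 (P? x))

-- Extracting elements up to permutation; duplicate-free lists

module _ {A : Set} where

  extract : ∀ {x} {xs : List A} → x ∈ xs → ∃ λ ys → xs ↭ x ∷ ys
  extract x∈ with ys , zs , refl ← ∈-∃++ x∈ = ys ++ zs , shift _ ys zs

  ∈-↭-≢ : ∀ {x y} {xs ys : List A} → xs ↭ x ∷ ys → y ∈ xs → y ≢ x → y ∈ ys
  ∈-↭-≢ p y∈ y≢x with ∈-resp-↭ p y∈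
  ... | here y≡x  = contradiction y≡x y≢x
  ... | there y∈′ = y∈′

  ↭-head∈ : ∀ {x} {xs ys : List A} → xs ↭ x ∷ ys → x ∈ xs
  ↭-head∈ p = ∈-resp-↭ (↭-sym p) (here refl)

  ↭-tail⊆ : ∀ {x y} {xs ys : List A} → xs ↭ x ∷ ys → y ∈ ys → y ∈ xs
  ↭-tail⊆ p y∈ = ∈-resp-↭ (↭-sym p) (there y∈)

  Unique-resp-↭ : ∀ {xs ys : List A} → xs ↭ ys → Unique xs → Unique ys
  Unique-resp-↭ p = Permₛ.Unique-resp-↭ (setoid A) (↭⇒↭ₛ p)

  Unique-uncons : ∀ {x} {xs ys : List A} → xs ↭ x ∷ ys → Unique xs → x ∉ ys × Unique ys
  Unique-uncons p u with Unique-resp-↭ p u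
  ... | u′@(_ ∷ uys) = Unique[x∷xs]⇒x∉xs u′ , uys

  ∷-Unique : ∀ {x} {xs : List A} → x ∉ xs → Unique xs → Unique (x ∷ xs)
  ∷-Unique x∉ u = ¬Any⇒All¬ _ x∉ ∷ u

  unique-⊆-length : ∀ {xs ys : List A} → Unique xs → (∀ {x} → x ∈ xs → x ∈ ys) → length xs ≤ length ys
  unique-⊆-length {[]}     u       xs⊆ys = z≤n
  unique-⊆-length {x ∷ xs} (x∉ ∷ u) xs⊆ys with zs , p ← extract (xs⊆ys (here refl)) =
    subst (suc (length xs) ≤_) (sym (↭-length p))
      (s≤s (unique-⊆-length u λ y∈ → ∈-↭-≢ p (xs⊆ys (there y∈)) λ { refl → All.lookup x∉ y∈ refl }))

module _ {A : Set} {P : A → Set} (P? : Decidable P) where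

  count≡length-filter : ∀ xs → count P? xs ≡ length (filter P? xs)
  count≡length-filter [] = refl
  count≡length-filter (x ∷ xs) with P? x
  ... | yes _ = cong suc (count≡length-filter xs)
  ... | no  _ = count≡length-filter xs

  unique-length≤count : ∀ {xs ys} → Unique xs → (∀ {x} → x ∈ xs → x ∈ ys × P x) → length xs ≤ count P? ys
  unique-length≤count {xs} {ys} u h rewrite count≡length-filter ys =
    unique-⊆-length u λ x∈ → ∈-filter⁺ P? (proj₁ (h x∈)) (proj₂ (h x∈))

  unique-count≤length : ∀ {xs ys} → Unique xs → (∀ {x} → x ∈ xs → P x → x ∈ ys) → count P? xs ≤ length ys
  unique-count≤length {xs} u h rewrite count≡length-filter xs =
    unique-⊆-length (filter⁺ P? u) λ x∈ → case ∈-filter⁻ P? {xs = xs} x∈ of λ (x∈xs , px) → h x∈xs px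

  ¬All⇒count<length : ∀ {xs} → ¬ All P xs → count P? xs < length xs
  ¬All⇒count<length {xs} ¬all rewrite count≡length-filter xs = filter-notAll P? xs (¬All⇒Any¬ P? xs ¬all)

  length≤count⇒All : ∀ {xs} → length xs ≤ count P? xs → All P xs
  length≤count⇒All {xs} le with all? P? xs
  ... | yes all = all
  ... | no ¬all = contradiction (¬All⇒count<length ¬all) (≤⇒≯ le)

  All⇒count≡length : ∀ {xs} → All P xs → count P? xs ≡ length xs
  All⇒count≡length []               = refl
  All⇒count≡length (_∷_ {x} px pxs) = cong₂ _+_ (𝟙-yes (P? x) px) (All⇒count≡length pxs)

  -- A failing entry `v` contributes nothing to the count, so once it is removed the second
  -- inequality leaves no room for another failure.
  all-but-one : ∀ {xs} → count P? xs < length xs → length xs ≤ suc (count P? xs) →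
                ∃ λ v → v ∈ xs × ¬ P v × (∀ {u} → u ∈ xs → u ≢ v → P u)
  all-but-one {xs} lt le with all? P? xs
  ... | yes all = contradiction (All⇒count≡length all) (<⇒≢ lt)
  ... | no ¬all
    with v , v∈ , ¬pv ← find (¬All⇒Any¬ P? xs ¬all)
    with ys , p ← extract v∈ =
    v , v∈ , ¬pv , λ u∈ u≢v → All.lookup (length≤count⇒All le′) (∈-↭-≢ p u∈ u≢v)
    where
    le′ : length ys ≤ count P? ys
    le′ = s≤s⁻¹ (subst₂ _≤_ (↭-length p) (cong suc (trans (∑-↭ p _) (cong (_+ count P? ys) (𝟙-no (P? v) ¬pv)))) le)

-- Hall's theorem with capacities

module Hall {V : Set} (_≟ⱽ_ : DecidableEquality V) {Adj : V → ℕ → Set} (Adj? : ∀ v c → Dec (Adj v c))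
            {U : List ℕ} (U! : Unique U) (m : ℕ) where

  load : List V → (V → ℕ) → ℕ → ℕ
  load vs f c = ∑ vs λ v → 𝟙 (f v ≟ c)

  Allowed : List V → (V → ℕ) → Set
  Allowed vs f = ∀ {v} → v ∈ vs → f v ∈ U × Adj v (f v)

  Assignment : List V → Set
  Assignment vs = ∃ λ f → Allowed vs f × (∀ c → load vs f c ≤ m)

  Reached : List V → ℕ → Set
  Reached S c = Any (λ v → Adj v c) S

  reached? : ∀ S c → Dec (Reached S c)
  reached? S c = any? (λ v → Adj? v c) S

  neighbours : List V → ℕ
  neighbours S = count (reached? S) U

  -- A violator of Hall's condition when each colour of `U` may be used `m` times.
  Deficient : List V → Set
  Deficient vs = ∃ λ S → Unique S × (∀ {v} → v ∈ S → v ∈ vs) × m * neighbours S < length S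

  private
    _∈?ⱽ_ : ∀ v S → Dec (v ∈ S)
    v ∈?ⱽ S = any? (v ≟ⱽ_) S

    update : (V → ℕ) → V → ℕ → V → ℕ
    update g u y w with w ≟ⱽ u
    ... | yes _ = y
    ... | no _  = g w

    update-≡ : ∀ g u y → update g u y u ≡ y
    update-≡ g u y with u ≟ⱽ u
    ... | yes _  = refl
    ... | no u≢u = contradiction refl u≢u

    update-≢ : ∀ g u y {w} → w ≢ u → update g u y w ≡ g w
    update-≢ g u y {w} w≢u with w ≟ⱽ u
    ... | yes w≡u = contradiction w≡u w≢u
    ... | no _    = refl

    -- Recolouring `u` moves one unit of load from `g u` to `y`; adding the lost unit on the left
    -- avoids truncated subtraction.
    load-update : ∀ {vs} g u y c → Unique vs → u ∈ vs →
                  load vs (update g u y) c + 𝟙 (g u ≟ c) ≡ load vs g c + 𝟙 (y ≟ c)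
    load-update {vs} g u y c vs! u∈ with ws , p ← extract u∈ = begin
      load vs (update g u y) c + 𝟙 (g u ≟ c)                        ≡⟨ cong (_+ 𝟙 (g u ≟ c)) (∑-↭ p _) ⟩
      (𝟙 (update g u y u ≟ c) + load ws (update g u y) c) + 𝟙 (g u ≟ c)
        ≡⟨ cong₂ (λ a b → (𝟙 (a ≟ c) + b) + 𝟙 (g u ≟ c)) (update-≡ g u y)
             (∑-cong ws λ w∈ → cong (λ a → 𝟙 (a ≟ c)) (update-≢ g u y λ { refl → u∉ w∈ })) ⟩
      (𝟙 (y ≟ c) + load ws g c) + 𝟙 (g u ≟ c)                       ≡⟨ rotate (𝟙 (y ≟ c)) _ _ ⟩
      (𝟙 (g u ≟ c) + load ws g c) + 𝟙 (y ≟ c)                       ≡⟨ cong (_+ 𝟙 (y ≟ c)) (∑-↭ p _) ⟨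
      load vs g c + 𝟙 (y ≟ c)                                       ∎
      where
      open ≡-Reasoning
      u∉ = proj₁ (Unique-uncons p vs!)
      rotate : ∀ a b c → (a + b) + c ≡ (c + b) + a
      rotate = solve-∀

    -- R collects the vertices joined to v by an alternating path.  Instead of the path we keep, for every colour x
    -- adjacent to R, the colouring obtained by shifting colours along it, which gains one use of x and no other.
    module Augment (v : V) (ws : List V) (vs! : Unique (v ∷ ws))
                   (f : V → ℕ) (f-allowed : Allowed ws f) (f-load : ∀ c → load ws f c ≤ m) where

      vs : List V
      vs = v ∷ ws

      -- Agreement with `f` outside `R` guarantees that the next vertex to join `R` still has its
      -- old colour, so recolouring it releases that colour.
      Shifted : List V → ℕ → Set
      Shifted R x = ∃ λ g → Allowed vs g × (∀ c → load vs g c ≡ load ws f c + 𝟙 (x ≟ c)) × (∀ {u} → u ∉ R → g u ≡ f u)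

      Shiftable : List V → Set
      Shiftable R = ∀ {x} → x ∈ U → Reached R x → Shifted R x

      start : Shiftable (v ∷ [])
      start {x} x∈U (here v~x) = update f v x , allowed , load-eq , λ u∉ → update-≢ f v x (u∉ ∘ here)
        where
        v∉ : v ∉ ws
        v∉ = Unique[x∷xs]⇒x∉xs vs!
        agree : ∀ {w} → w ∈ ws → update f v x w ≡ f w
        agree w∈ = update-≢ f v x λ { refl → v∉ w∈ }
        allowed : Allowed vs (update f v x)
        allowed (here refl) rewrite update-≡ f v x = x∈U , v~x
        allowed (there w∈)  rewrite agree w∈ = f-allowed w∈
        load-eq : ∀ c → load vs (update f v x) c ≡ load ws f c + 𝟙 (x ≟ c)
        load-eq c = trans (cong₂ _+_ (cong (λ a → 𝟙 (a ≟ c)) (update-≡ f v x)) (∑-cong ws λ w∈ → cong (λ a → 𝟙 (a ≟ c)) (agree w∈)))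
                          (+-comm (𝟙 (x ≟ c)) _)

      -- The colouring with one extra use of `f u` still gives `u` the colour `f u`; switching `u`
      -- to `x` hands the extra use on to `x`.
      extend : ∀ {R u} → Shiftable R → u ∈ ws → u ∉ R → Reached R (f u) → Shiftable (u ∷ R)
      extend sh u∈ u∉R r {x} x∈U (there rx) with g , al , ld , off ← sh x∈U rx = g , al , ld , λ w∉ → off (w∉ ∘ there)
      extend {R} {u} sh u∈ u∉R r {x} x∈U (here u~x) with g , al , ld , off ← sh (proj₁ (f-allowed u∈)) r =
        update g u x , allowed , load-eq , λ w∉ → trans (update-≢ g u x (w∉ ∘ here)) (off (w∉ ∘ there))
        where
        open ≡-Reasoning
        allowed : Allowed vs (update g u x)
        allowed {w} w∈ with w ≟ⱽ u
        ... | yes refl = x∈U , u~x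
        ... | no _     = al w∈
        swap-last : ∀ a b c → (a + b) + c ≡ (a + c) + b
        swap-last = solve-∀
        load-eq : ∀ c → load vs (update g u x) c ≡ load ws f c + 𝟙 (x ≟ c)
        load-eq c = +-cancelʳ-≡ (𝟙 (f u ≟ c)) _ _ (begin
          load vs (update g u x) c + 𝟙 (f u ≟ c)      ≡⟨ cong (λ a → load vs (update g u x) c + 𝟙 (a ≟ c)) (off u∉R) ⟨
          load vs (update g u x) c + 𝟙 (g u ≟ c)      ≡⟨ load-update g u x c vs! (there u∈) ⟩
          load vs g c + 𝟙 (x ≟ c)                     ≡⟨ cong (_+ 𝟙 (x ≟ c)) (ld c) ⟩
          (load ws f c + 𝟙 (f u ≟ c)) + 𝟙 (x ≟ c)     ≡⟨ swap-last (load ws f c) _ _ ⟩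
          (load ws f c + 𝟙 (x ≟ c)) + 𝟙 (f u ≟ c)     ∎)

      finish : ∀ {R x} → Shiftable R → x ∈ U → Reached R x → load ws f x < m → Assignment vs
      finish {R} {x} sh x∈U r slack with g , al , ld , _ ← sh x∈U r = g , al , bound
        where
        bound : ∀ c → load vs g c ≤ m
        bound c rewrite ld c with x ≟ c
        ... | yes refl = subst (_≤ m) (+-comm 1 _) slack
        ... | no _     = subst (_≤ m) (sym (+-identityʳ _)) (f-load c)

      -- Every reached colour is used at least `m` times on `ws`, and only by vertices of `R`. Hence
      -- `m * neighbours R` is at most the number of vertices of `ws` in `R`, and `v` is one more
      -- vertex of `R`.
      closed⇒deficient : ∀ {R} → Unique R → v ∈ R →
                         (∀ {x} → x ∈ U → Reached R x → m ≤ load ws f x) →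
                         (∀ {u} → u ∈ ws → Reached R (f u) → u ∈ R) →
                         m * neighbours R < length R
      closed⇒deficient {R} R! v∈R full closed = begin-strict
        m * neighbours R                                          ≡⟨ ∑-*ˡ U m _ ⟨
        ∑ U (λ x → m * 𝟙 (reached? R x))                          ≤⟨ ∑-mono U saturated ⟩
        ∑ U (λ x → ∑ ws λ u → 𝟙 (reached? R x) * 𝟙 (f u ≟ x))     ≡⟨ ∑-swap U ws _ ⟩
        ∑ ws (λ u → ∑ U λ x → 𝟙 (reached? R x) * 𝟙 (f u ≟ x))     ≤⟨ ∑-mono ws confined ⟩
        ∑ ws (λ u → 𝟙 (u ∈?ⱽ R))                                  <⟨ n<1+n _ ⟩
        suc (∑ ws (λ u → 𝟙 (u ∈?ⱽ R)))                            ≡⟨ cong (_+ ∑ ws (λ u → 𝟙 (u ∈?ⱽ R))) (𝟙-yes (v ∈?ⱽ R) v∈R) ⟨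
        count (_∈?ⱽ R) vs                                         ≤⟨ unique-count≤length (_∈?ⱽ R) vs! (λ _ → id) ⟩
        length R                                                  ∎
        where
        open ≤-Reasoning
        saturated : ∀ {x} → x ∈ U → m * 𝟙 (reached? R x) ≤ ∑ ws (λ u → 𝟙 (reached? R x) * 𝟙 (f u ≟ x))
        saturated {x} x∈U rewrite ∑-*ˡ ws (𝟙 (reached? R x)) (λ u → 𝟙 (f u ≟ x)) with reached? R x
        ... | yes r rewrite *-identityʳ m | *-identityˡ (load ws f x) = full x∈U r
        ... | no _  rewrite *-zeroʳ m = z≤n
        only-own-colour : ∀ u → ∑ U (λ x → 𝟙 (f u ≟ x)) ≤ 1
        only-own-colour u = unique-count≤length {P = λ x → f u ≡ x} (f u ≟_) {ys = f u ∷ []} U! λ { _ refl → here refl }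
        confined : ∀ {u} → u ∈ ws → ∑ U (λ x → 𝟙 (reached? R x) * 𝟙 (f u ≟ x)) ≤ 𝟙 (u ∈?ⱽ R)
        confined {u} u∈ = begin
          ∑ U (λ x → 𝟙 (reached? R x) * 𝟙 (f u ≟ x))  ≤⟨ ∑-mono U pointwise ⟩
          ∑ U (λ x → 𝟙 (u ∈?ⱽ R) * 𝟙 (f u ≟ x))       ≡⟨ ∑-*ˡ U (𝟙 (u ∈?ⱽ R)) _ ⟩
          𝟙 (u ∈?ⱽ R) * ∑ U (λ x → 𝟙 (f u ≟ x))       ≤⟨ *-monoʳ-≤ (𝟙 (u ∈?ⱽ R)) (only-own-colour u) ⟩
          𝟙 (u ∈?ⱽ R) * 1                             ≡⟨ *-identityʳ _ ⟩
          𝟙 (u ∈?ⱽ R)                                 ∎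
          where
          pointwise : ∀ {x} → x ∈ U → 𝟙 (reached? R x) * 𝟙 (f u ≟ x) ≤ 𝟙 (u ∈?ⱽ R) * 𝟙 (f u ≟ x)
          pointwise {x} _ with reached? R x | f u ≟ x | u ∈?ⱽ R
          ... | no _  | _        | _     = z≤n
          ... | yes _ | no _     | _     = z≤n
          ... | yes _ | yes _    | yes _ = ≤-refl
          ... | yes r | yes refl | no u∉ = contradiction (closed u∈ r) u∉

      -- Each round stops at a reached colour with spare capacity, stops at a closed `R`, or adds a
      -- vertex to `R`. The fuel cannot run out, since `R` is duplicate-free and contained in `vs`.
      grow : ∀ n R → Unique R → (∀ {u} → u ∈ R → u ∈ vs) → v ∈ R → length vs < n + length R → Shiftable R →
             Assignment vs ⊎ Deficient vs
      grow zero    R R! R⊆ v∈R fuel sh = contradiction (unique-⊆-length R! R⊆) (<⇒≱ fuel)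
      grow (suc n) R R! R⊆ v∈R fuel sh with any? (λ x → reached? R x ×-dec (load ws f x <? m)) U
      ... | yes slack with x , x∈U , r , lt ← find slack = inj₁ (finish sh x∈U r lt)
      ... | no tight with any? (λ u → reached? R (f u) ×-dec ¬? (u ∈?ⱽ R)) ws
      ...   | yes new with u , u∈ , r , u∉R ← find new =
              grow n (u ∷ R) (∷-Unique u∉R R!) (λ { (here refl) → there u∈ ; (there w∈) → R⊆ w∈ }) (there v∈R)
                   (subst (length vs <_) (sym (+-suc n (length R))) fuel) (extend sh u∈ u∉R r)
      ...   | no closed = inj₂ (R , R! , R⊆ , closed⇒deficient R! v∈R
                (λ x∈U r → ≮⇒≥ λ lt → tight (lose x∈U (r , lt)))
                (λ {u} u∈ r → case u ∈?ⱽ R of λ { (yes u∈R) → u∈R ; (no u∉R) → contradiction (lose u∈ (r , u∉R)) closed }))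

      augment : Assignment vs ⊎ Deficient vs
      augment = grow (length vs) (v ∷ []) ([] ∷ []) (λ { (here refl) → here refl }) (here refl)
                     (subst (length vs <_) (+-comm 1 (length vs)) ≤-refl) start

  -- Vertices are inserted one at a time; a violator found in the tail is a violator for the whole
  -- list.
  hall : ∀ {vs} → Unique vs → Assignment vs ⊎ Deficient vs
  hall {[]}     _   = inj₁ ((λ _ → 0) , (λ ()) , λ _ → z≤n)
  hall {v ∷ ws} vs!@(_ ∷ ws!) with hall ws!
  ... | inj₁ (f , al , ld)        = Augment.augment v ws vs! f al ld
  ... | inj₂ (S , S! , S⊆ , lack) = inj₂ (S , S! , there ∘ S⊆ , lack)

-- Choosability

vertex-≟ : ∀ {k} {p : Fin k → ℕ} → DecidableEquality (Σ (Fin k) (Fin ∘ p))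
vertex-≟ = ≡-dec Fin._≟_ Fin._≟_

-- Vertex lists of families of parts

module Parts {k : ℕ} (p : Fin k → ℕ) where

  Vertex : Set
  Vertex = Σ (Fin k) (Fin ∘ p)

  vertex : ∀ i → Fin (p i) → Vertex
  vertex = _,_

  members : Fin k → List Vertex
  members i = map (vertex i) (allFin (p i))

  length-members : ∀ i → length (members i) ≡ p i
  length-members i = trans (length-map (vertex i) (allFin (p i))) (length-tabulate id)

  ∈-members : ∀ v → v ∈ members (proj₁ v)
  ∈-members (i , x) = ∈-map⁺ (vertex i) (∈-allFin x)

  members-part : ∀ {v i} → v ∈ members i → proj₁ v ≡ i
  members-part {i = i} v∈ with _ , _ , refl ← ∈-map⁻ (vertex i) v∈ = refl

  members-! : ∀ i → Unique (members i)
  members-! i = map⁺ (λ { refl → refl }) (allFin⁺ (p i))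

  vertices : List (Fin k) → List Vertex
  vertices = concatMap members

  ∈-vertices⁺ : ∀ {v Ts} → proj₁ v ∈ Ts → v ∈ vertices Ts
  ∈-vertices⁺ {v} v∈ = ∈-concatMap⁺ members (lose v∈ (∈-members v))

  ∈-vertices⁻ : ∀ {v} Ts → v ∈ vertices Ts → proj₁ v ∈ Ts
  ∈-vertices⁻ Ts v∈ with i , i∈ , v∈i ← find (∈-concatMap⁻ members {xs = Ts} v∈) = subst (_∈ Ts) (sym (members-part v∈i)) i∈

  vertices-! : ∀ {Ts} → Unique Ts → Unique (vertices Ts)
  vertices-! {[]}     _ = []
  vertices-! {i ∷ Ts} Ts!@(_ ∷ Ts!′) = ++⁺ (members-! i) (vertices-! Ts!′) λ (v∈i , v∈Ts) →
    Unique[x∷xs]⇒x∉xs Ts! (subst (_∈ Ts) (members-part v∈i) (∈-vertices⁻ Ts v∈Ts))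

-- Here `r` is `suc m`, and `ex i` is the excess of part `i` over `r`: 1 for a large part, 0
-- otherwise.
module Choose {k : ℕ} (m : ℕ) (ex : Fin k → ℕ) (p : Fin k → ℕ) (p≡ : ∀ i → p i ≡ suc m + ex i) (ex≤1 : ∀ i → ex i ≤ 1)
              (L : Σ (Fin k) (Fin ∘ p) → List ℕ) where

  open Parts p

  p≤ : ∀ i → p i ≤ suc (suc m)
  p≤ i rewrite p≡ i | +-comm m (ex i) = s≤s (+-monoˡ-≤ m (ex≤1 i))

  p≥ : ∀ i → suc m ≤ p i
  p≥ i rewrite p≡ i = m≤m+n _ _

  -- A partial colouring, with properness stated positively: a monochromatic set of `r` active
  -- vertices lies in one part. Membership in `U` keeps its colours apart from those already
  -- deleted.
  record Colouring (Active : Vertex → Set) (U : List ℕ) : Set where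
    field
      colour  : Vertex → ℕ
      allowed : ∀ {v} → Active v → colour v ∈ U × colour v ∈ L v
      proper  : ∀ {e c} → Unique e → length e ≡ suc m → All Active e → All (λ v → colour v ≡ c) e →
                ∃ λ i → All (λ v → proj₁ v ≡ i) e

  -- Since `c` is absent from `U′`, an active vertex gets colour `c` only if it is painted, hence
  -- lies in part `i`; every other class comes from the smaller colouring.
  paint : ∀ {Active Active′ X : Vertex → Set} {U U′ c i} → (∀ v → Dec (X v)) → Unique U → U ↭ c ∷ U′ →
          (∀ {v} → X v → proj₁ v ≡ i × c ∈ L v) → (∀ {v} → Active v → ¬ X v → Active′ v) →
          Colouring Active′ U′ → Colouring Active U
  paint {Active} {Active′} {X} {U} {U′} {c} {i} X? U! U↭ X⇒ rest C = record
    { colour = col ; allowed = allowed ; proper = proper }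
    where
    module C = Colouring C
    col : Vertex → ℕ
    col v with X? v
    ... | yes _ = c
    ... | no _  = C.colour v
    allowed : ∀ {v} → Active v → col v ∈ U × col v ∈ L v
    allowed {v} a with X? v
    ... | yes x = ↭-head∈ U↭ , proj₂ (X⇒ x)
    ... | no ¬x with C.allowed (rest a ¬x)
    ...   | ∈U , ∈L = ↭-tail⊆ U↭ ∈U , ∈L
    painted : ∀ {v} → Active v → col v ≡ c → proj₁ v ≡ i
    painted {v} a eq with X? v
    ... | yes x = proj₁ (X⇒ x)
    ... | no ¬x = contradiction (subst (_∈ U′) eq (proj₁ (C.allowed (rest a ¬x)))) (proj₁ (Unique-uncons U↭ U!))
    unpainted : ∀ {v c′} → c′ ≢ c → Active v → col v ≡ c′ → Active′ v × C.colour v ≡ c′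
    unpainted {v} c′≢c a eq with X? v
    ... | yes x = contradiction (sym eq) c′≢c
    ... | no ¬x = rest a ¬x , eq
    proper : ∀ {e c′} → Unique e → length e ≡ suc m → All Active e → All (λ v → col v ≡ c′) e →
             ∃ λ i → All (λ v → proj₁ v ≡ i) e
    proper {e} {c′} e! len act mono with c′ ≟ c
    ... | yes refl = i , All.zipWith (λ (a , eq) → painted a eq) (act , mono)
    ... | no c′≢c  = C.proper e! len (All.map proj₁ both) (All.map proj₂ both)
      where both = All.zipWith (λ (a , eq) → unpainted c′≢c a eq) (act , mono)

  avail : List ℕ → Vertex → ℕ
  avail U v = count (_∈? L v) U

  deg : Fin k → ℕ → ℕ
  deg i c = count (λ v → c ∈? L v) (members i)

  avail-↭ : ∀ {U U′ c} → U ↭ c ∷ U′ → ∀ v → avail U v ≡ 𝟙 (c ∈? L v) + avail U′ v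
  avail-↭ U↭ v = ∑-↭ U↭ _

  avail-drop : ∀ {U U′ c n} → U ↭ c ∷ U′ → ∀ v → suc n ≤ avail U v → n ≤ avail U′ v
  avail-drop {c = c} U↭ v le rewrite avail-↭ U↭ v =
    s≤s⁻¹ (≤-trans le (+-monoˡ-≤ _ (𝟙≤1 (c ∈? L v))))

  Active : List (Fin k) → List Vertex → Vertex → Set
  Active Ts Z v = proj₁ v ∈ Ts ⊎ v ∈ Z

  -- The invariant while colours are deleted. By `deg<`, a deletion takes at most `p i - 1` from the
  -- sum in `richPart`, while `p i * length Ts` drops by `p i` and `Z` gains one vertex. In `few`, a
  -- large part that is split trades its unit of excess for a vertex of `Z`.
  record State (Ts : List (Fin k)) (Z : List Vertex) (U : List ℕ) : Set where
    field
      Ts!      : Unique Ts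
      U!       : Unique U
      Z!       : Unique Z
      Z∉Ts     : ∀ {z} → z ∈ Z → proj₁ z ∉ Ts
      deg<     : ∀ {i c} → i ∈ Ts → c ∈ U → deg i c < p i
      rich     : ∀ {v} → proj₁ v ∈ Ts → length Ts ≤ avail U v
      richPart : ∀ {i} → i ∈ Ts → p i * length Ts + length Z ≤ ∑ (members i) (avail U)
      richZ    : ∀ {z} → z ∈ Z → suc (length Ts) ≤ avail U z
      few      : ∑ Ts ex + length Z ≤ m

  -- Hall's condition when every colour occurs at most `m` times in each part

  module Balanced {Ts Z U} (st : State Ts Z U) (deg≤m : ∀ {i c} → i ∈ Ts → c ∈ U → deg i c ≤ m) where
    open State st
    open Hall vertex-≟ (λ v c → c ∈? L v) U! m

    t = length Ts

    vs : List Vertex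
    vs = vertices Ts ++ Z

    vs! : Unique vs
    vs! = ++⁺ (vertices-! Ts!) Z! λ (v∈Ts , v∈Z) → Z∉Ts v∈Z (∈-vertices⁻ Ts v∈Ts)

    not-deficient : ¬ Deficient vs
    not-deficient (S , S! , S⊆ , lack) = <⇒≱ lack enough
      where
      _∈S? : ∀ v → Dec (v ∈ S)
      v ∈S? = any? (vertex-≟ v) S
      N = neighbours S

      s : Fin k → ℕ
      s i = count _∈S? (members i)

      zs = count _∈S? Z

      s≤p : ∀ i → s i ≤ p i
      s≤p i = begin
        s i                        ≤⟨ ∑-mono (members i) (λ {v} _ → 𝟙≤1 (v ∈S?)) ⟩
        ∑ (members i) (λ _ → 1)    ≡⟨ ∑-const (members i) 1 ⟩
        length (members i) * 1     ≡⟨ trans (*-identityʳ _) (length-members i) ⟩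
        p i                        ∎
        where open ≤-Reasoning

      zs≤ : zs ≤ length Z
      zs≤ = unique-count≤length _∈S? Z! λ z∈ _ → z∈

      size : ∀ {f} → (∀ {i} → i ∈ Ts → s i ≤ f i) → length S ≤ ∑ Ts f + zs
      size {f} s≤f = begin
        length S                          ≤⟨ unique-length≤count _∈S? S! (λ v∈ → S⊆ v∈ , v∈) ⟩
        count _∈S? vs                     ≡⟨ ∑-++ (vertices Ts) Z _ ⟩
        count _∈S? (vertices Ts) + zs     ≡⟨ cong (_+ zs) (∑-concatMap Ts members _) ⟩
        ∑ Ts s + zs                       ≤⟨ +-monoˡ-≤ zs (∑-mono Ts s≤f) ⟩
        ∑ Ts f + zs                       ∎
        where open ≤-Reasoning

      size-const : ∀ {a} → (∀ {i} → i ∈ Ts → s i ≤ a) → length S ≤ a * t + length Z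
      size-const {a} s≤a = begin
        length S               ≤⟨ size s≤a ⟩
        ∑ Ts (λ _ → a) + zs    ≤⟨ +-mono-≤ (≤-reflexive (trans (∑-const Ts a) (*-comm t a))) zs≤ ⟩
        a * t + length Z       ∎
        where open ≤-Reasoning

      avail≤N : ∀ {v} → v ∈ S → avail U v ≤ N
      avail≤N {v} v∈ = ∑-mono U λ {c} _ → 𝟙-mono (c ∈? L v) (reached? S c) (lose v∈)

      -- Double counting of the pairs (v , c) with v in S and part i: no colour occurs more than m times.
      weight : ∀ {i} → i ∈ Ts → ∑ (members i) (λ v → 𝟙 (v ∈S?) * avail U v) ≤ m * N
      weight {i} i∈ = begin
        ∑ (members i) (λ v → 𝟙 (v ∈S?) * avail U v)                        ≡⟨ ∑-cong (members i) (λ {v} _ → sym (∑-*ˡ U (𝟙 (v ∈S?)) _)) ⟩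
        ∑ (members i) (λ v → ∑ U λ c → 𝟙 (v ∈S?) * 𝟙 (c ∈? L v))           ≡⟨ ∑-swap (members i) U _ ⟩
        ∑ U (λ c → ∑ (members i) λ v → 𝟙 (v ∈S?) * 𝟙 (c ∈? L v))           ≤⟨ ∑-mono U perColour ⟩
        ∑ U (λ c → m * 𝟙 (reached? S c))                                   ≡⟨ ∑-*ˡ U m _ ⟩
        m * N                                                              ∎
        where
        open ≤-Reasoning
        perColour : ∀ {c} → c ∈ U → ∑ (members i) (λ v → 𝟙 (v ∈S?) * 𝟙 (c ∈? L v)) ≤ m * 𝟙 (reached? S c)
        perColour {c} c∈ with reached? S c
        ... | yes _ = begin
          ∑ (members i) (λ v → 𝟙 (v ∈S?) * 𝟙 (c ∈? L v))    ≤⟨ ∑-mono (members i) (λ {v} _ → *-monoˡ-≤ (𝟙 (c ∈? L v)) (𝟙≤1 (v ∈S?))) ⟩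
          ∑ (members i) (λ v → 1 * 𝟙 (c ∈? L v))            ≡⟨ trans (∑-*ˡ (members i) 1 _) (*-identityˡ _) ⟩
          deg i c                                          ≤⟨ deg≤m i∈ c∈ ⟩
          m                                                ≡⟨ *-identityʳ m ⟨
          m * 1                                            ∎
        ... | no ¬r = ≤-trans (∑-mono (members i) unreached) (≤-trans (≤-reflexive (∑-zero (members i))) z≤n)
          where
          unreached : ∀ {v} → v ∈ members i → 𝟙 (v ∈S?) * 𝟙 (c ∈? L v) ≤ 0
          unreached {v} _ with v ∈S? | c ∈? L v
          ... | no _   | _      = z≤n
          ... | yes _  | no _   = z≤n
          ... | yes v∈ | yes c∈ = contradiction (lose v∈ c∈) ¬r

      weight-s : ∀ {i} → i ∈ Ts → s i * t ≤ m * N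
      weight-s {i} i∈ = begin
        s i * t                                        ≡⟨ *-comm (s i) t ⟩
        t * s i                                        ≡⟨ ∑-*ˡ (members i) t _ ⟨
        ∑ (members i) (λ v → t * 𝟙 (v ∈S?))            ≤⟨ ∑-mono (members i) scale ⟩
        ∑ (members i) (λ v → 𝟙 (v ∈S?) * avail U v)    ≤⟨ weight i∈ ⟩
        m * N                                          ∎
        where
        open ≤-Reasoning
        scale : ∀ {v} → v ∈ members i → t * 𝟙 (v ∈S?) ≤ 𝟙 (v ∈S?) * avail U v
        scale {v} v∈ rewrite *-comm t (𝟙 (v ∈S?)) = *-monoʳ-≤ (𝟙 (v ∈S?)) (rich (subst (_∈ Ts) (sym (members-part v∈)) i∈))

      -- With the whole part inside `S`, all its available colours enter the double count, and
      -- `richPart` bounds their number from below.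
      weight-full : ∀ {i} → i ∈ Ts → p i ≤ s i → p i * t + length Z ≤ m * N
      weight-full {i} i∈ full = begin
        p i * t + length Z                             ≤⟨ richPart i∈ ⟩
        ∑ (members i) (avail U)                        ≤⟨ ∑-mono (members i) inS ⟩
        ∑ (members i) (λ v → 𝟙 (v ∈S?) * avail U v)    ≤⟨ weight i∈ ⟩
        m * N                                          ∎
        where
        open ≤-Reasoning
        all-in : All (_∈ S) (members i)
        all-in = length≤count⇒All _∈S? (subst (_≤ s i) (sym (length-members i)) full)
        inS : ∀ {v} → v ∈ members i → avail U v ≤ 𝟙 (v ∈S?) * avail U v
        inS {v} v∈ rewrite 𝟙-yes (v ∈S?) (All.lookup all-in v∈) = ≤-reflexive (sym (*-identityˡ _))

      few-spare : ∀ {a} → a ≤ m → t < N → m * t + a ≤ m * N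
      few-spare {a} a≤m t<N = begin
        m * t + a    ≤⟨ +-monoʳ-≤ (m * t) a≤m ⟩
        m * t + m    ≡⟨ trans (+-comm (m * t) m) (sym (*-suc m t)) ⟩
        m * suc t    ≤⟨ *-monoʳ-≤ m t<N ⟩
        m * N        ∎
        where open ≤-Reasoning

      -- At least `(m + 1) t` incidences with at most `m` per colour need more than `t` colours;
      -- strictness holds because `t` is positive, `i` being one of the parts.
      many-colours : ∀ {i} → i ∈ Ts → m < s i → t < N
      many-colours {i} i∈ m<s = *-cancelˡ-< m t N (begin-strict
        m * t        <⟨ +-monoˡ-≤ (m * t) (∈-length i∈) ⟩
        suc m * t    ≤⟨ *-monoˡ-≤ t m<s ⟩
        s i * t      ≤⟨ weight-s i∈ ⟩
        m * N        ∎)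
        where open ≤-Reasoning

      ¬any⇒≤ : ∀ {f g : Fin k → ℕ} → ¬ Any (λ i → f i < g i) Ts → ∀ {i} → i ∈ Ts → g i ≤ f i
      ¬any⇒≤ none i∈ = ≮⇒≥ λ lt → none (lose i∈ lt)

      enough : length S ≤ m * N
      enough with any? (λ i → suc m <? s i) Ts
      -- Parts have at most `m + 2` vertices, so this one has exactly that many and lies entirely in
      -- `S`.
      ... | yes some with i , i∈ , le ← find some = begin
        length S                        ≤⟨ size-const (λ {i} _ → ≤-trans (s≤p i) (p≤ i)) ⟩
        suc (suc m) * t + length Z      ≤⟨ +-monoˡ-≤ (length Z) (*-monoˡ-≤ t (≤-trans le (s≤p i))) ⟩
        p i * t + length Z              ≤⟨ weight-full i∈ (≤-trans (p≤ i) le) ⟩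
        m * N                           ∎
        where open ≤-Reasoning
      ... | no none₁ with any? (λ i → p i ≤? s i) Ts
      -- Now each part contributes at most `m + 1`, and some part, of at least that size, lies
      -- entirely in `S`.
      ...   | yes some with i , i∈ , le ← find some = begin
        length S                  ≤⟨ size-const (¬any⇒≤ none₁) ⟩
        suc m * t + length Z      ≤⟨ +-monoˡ-≤ (length Z) (*-monoˡ-≤ t (p≥ i)) ⟩
        p i * t + length Z        ≤⟨ weight-full i∈ le ⟩
        m * N                     ∎
        where open ≤-Reasoning
      ...   | no none₂ with any? (λ i → m <? s i) Ts
      -- No part lies entirely in `S`, so each contributes at most `m + ex i`. By `few` the excesses
      -- together with `Z` amount to at most `m`, which the colour beyond `t` absorbs.
      ...     | yes some with i , i∈ , lt ← find some = begin
        length S                           ≤⟨ size s≤m+ex ⟩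
        ∑ Ts (λ i → m + ex i) + zs         ≡⟨ cong (_+ zs) (∑-+ Ts (λ _ → m) ex) ⟩
        (∑ Ts (λ _ → m) + ∑ Ts ex) + zs    ≡⟨ +-assoc (∑ Ts (λ _ → m)) _ _ ⟩
        ∑ Ts (λ _ → m) + (∑ Ts ex + zs)    ≡⟨ cong (_+ (∑ Ts ex + zs)) (trans (∑-const Ts m) (*-comm t m)) ⟩
        m * t + (∑ Ts ex + zs)             ≤⟨ few-spare (≤-trans (+-monoʳ-≤ (∑ Ts ex) zs≤) few) (many-colours i∈ lt) ⟩
        m * N                              ∎
        where
        open ≤-Reasoning
        s≤m+ex : ∀ {i} → i ∈ Ts → s i ≤ m + ex i
        s≤m+ex {i} i∈ = s≤s⁻¹ (subst (s i <_) (p≡ i) (≰⇒> λ le → none₂ (lose i∈ le)))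
      ...     | no none₃ with any? _∈S? Z
      ...       | yes some with z , z∈Z , z∈S ← find some =
        ≤-trans (size-const (¬any⇒≤ none₃)) (few-spare (m+n≤o⇒n≤o (∑ Ts ex) few) (≤-trans (richZ z∈Z) (avail≤N z∈S)))
      ...       | no none₄ = nonempty refl
        where
        zs≡0 : zs ≡ 0
        zs≡0 = trans (∑-cong Z λ {z} z∈ → 𝟙-no (z ∈S?) λ z∈S → none₄ (lose z∈ z∈S)) (∑-zero Z)
        -- The bound `t ≤ N` needs a vertex of `S`, so the empty set is treated separately.
        nonempty : ∀ {S′} → S ≡ S′ → length S ≤ m * N
        nonempty {[]}    refl = z≤n
        nonempty {w ∷ _} refl with ∈-++⁻ (vertices Ts) (S⊆ (here refl))
        ... | inj₂ w∈Z = contradiction (lose w∈Z (here refl)) none₄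
        ... | inj₁ w∈Ts = begin
          length S               ≤⟨ size (¬any⇒≤ none₃) ⟩
          ∑ Ts (λ _ → m) + zs    ≡⟨ trans (cong₂ _+_ (trans (∑-const Ts m) (*-comm t m)) zs≡0) (+-identityʳ _) ⟩
          m * t                  ≤⟨ *-monoʳ-≤ m (≤-trans (rich (∈-vertices⁻ Ts w∈Ts)) (avail≤N (here refl))) ⟩
          m * N                  ∎
          where open ≤-Reasoning

    active∈vs : ∀ {v} → Active Ts Z v → v ∈ vs
    active∈vs (inj₁ v∈) = ∈-++⁺ˡ (∈-vertices⁺ v∈)
    active∈vs (inj₂ v∈) = ∈-++⁺ʳ (vertices Ts) v∈

    colouring : Colouring (Active Ts Z) U
    colouring with hall vs!
    ... | inj₂ def = contradiction def not-deficient
    ... | inj₁ (f , al , ld) = record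
      { colour  = f
      ; allowed = al ∘ active∈vs
      -- Capacity `m` leaves no colour on `m + 1` active vertices, so no monochromatic `e` exists.
      ; proper  = λ {e} {c} e! len act mono → contradiction
          (≤-trans (unique-length≤count (λ v → f v ≟ c) e! λ v∈ → active∈vs (All.lookup act v∈) , All.lookup mono v∈) (ld c))
          (<⇒≱ (≤-reflexive (sym len)))
      }

  -- When m + 1 of the m + 2 vertices of a large part share a colour, they receive it and the last vertex is put in Z.
  split-large : ∀ n {Ts Z U} → length Ts < n → State Ts Z U → Colouring (Active Ts Z) U
  split-large (suc n) {Ts} {Z} {U} fuel st with any? (λ i → any? (λ c → m <? deg i c) U) Ts
  ... | no none = Balanced.colouring st λ i∈ c∈ → ≮⇒≥ λ lt → none (lose i∈ (lose c∈ lt))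
  ... | yes some
    with i , i∈ , some′ ← find some
    with c , c∈ , m<deg ← find some′
    -- Exactly one vertex misses `c`: its degree exceeds `m` and is below `p i`, which is at most
    -- `m + 2`.
    with v , v∈ , c∉Lv , others ← all-but-one (λ v → c ∈? L v) {members i}
           (subst (deg i c <_) (sym (length-members i)) (State.deg< st i∈ c∈))
           (subst (_≤ suc (deg i c)) (sym (length-members i)) (≤-trans (p≤ i) (s≤s m<deg)))
    with Ts′ , Ts↭ ← extract i∈
    with U′ , U↭ ← extract c∈ =
    paint X? U! U↭ (λ { {u} (refl , u≢v) → refl , others (∈-members u) u≢v }) rest
          (split-large n (s≤s⁻¹ (subst (_< suc n) len fuel)) st′)
    where
    open State st
    len = ↭-length Ts↭
    X? : ∀ u → Dec (proj₁ u ≡ i × u ≢ v)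
    X? u = (proj₁ u Fin.≟ i) ×-dec ¬? (vertex-≟ u v)
    v∈Ts : proj₁ v ∈ Ts
    v∈Ts = subst (_∈ Ts) (sym (members-part v∈)) i∈
    rest : ∀ {u} → Active Ts Z u → ¬ (proj₁ u ≡ i × u ≢ v) → Active Ts′ (v ∷ Z) u
    rest         (inj₂ u∈) _  = inj₂ (there u∈)
    rest {u} (inj₁ u∈) ¬x with proj₁ u Fin.≟ i | vertex-≟ u v
    ... | no u≢i  | _       = inj₁ (∈-↭-≢ Ts↭ u∈ u≢i)
    ... | yes _   | yes u≡v = inj₂ (here u≡v)
    ... | yes u≡i | no u≢v  = contradiction (u≡i , u≢v) ¬x
    st′ : State Ts′ (v ∷ Z) U′
    st′ = record
      { Ts!  = proj₂ (Unique-uncons Ts↭ Ts!)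
      ; U!   = proj₂ (Unique-uncons U↭ U!)
      ; Z!   = ∷-Unique (λ v∈Z → Z∉Ts v∈Z v∈Ts) Z!
      ; Z∉Ts = λ { (here refl) v∈Ts′ → proj₁ (Unique-uncons Ts↭ Ts!) (subst (_∈ Ts′) (members-part v∈) v∈Ts′)
                 ; (there z∈) z∈Ts′ → Z∉Ts z∈ (↭-tail⊆ Ts↭ z∈Ts′) }
      ; deg< = λ j∈ c∈ → deg< (↭-tail⊆ Ts↭ j∈) (↭-tail⊆ U↭ c∈)
      ; rich = λ {u} u∈ → avail-drop U↭ u (subst (_≤ avail U u) len (rich (↭-tail⊆ Ts↭ u∈)))
      ; richPart = λ {j} j∈ → richPart′ (↭-tail⊆ Ts↭ j∈)
      ; richZ = λ { (here refl) → subst (suc (length Ts′) ≤_) (trans (avail-↭ U↭ v) (cong (_+ avail U′ v) (𝟙-no (c ∈? L v) c∉Lv)))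
                                     (subst (_≤ avail U v) len (rich v∈Ts))
                  ; {z} (there z∈) → avail-drop U↭ z (subst (λ a → suc a ≤ avail U z) len (richZ z∈)) }
      ; few = few′
      }
      where
      open ≤-Reasoning
      richPart′ : ∀ {j} → j ∈ Ts → p j * length Ts′ + suc (length Z) ≤ ∑ (members j) (avail U′)
      -- The loss `deg j c` is at most `p j - 1`, against a drop of `p j` in the product; the unit
      -- left over pays for the new vertex of `Z`.
      richPart′ {j} j∈ = +-cancelˡ-≤ (deg j c) _ _ (s≤s⁻¹ (begin
        suc (deg j c) + (p j * length Ts′ + suc (length Z))     ≤⟨ +-monoˡ-≤ _ (deg< j∈ c∈) ⟩
        p j + (p j * length Ts′ + suc (length Z))               ≡⟨ regroup (p j) (length Ts′) (length Z) ⟩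
        suc (p j * suc (length Ts′) + length Z)                 ≡⟨ cong (λ a → suc (p j * a + length Z)) len ⟨
        suc (p j * length Ts + length Z)                        ≤⟨ s≤s (richPart j∈) ⟩
        suc (∑ (members j) (avail U))                           ≡⟨ cong suc (∑-cong (members j) λ {u} _ → avail-↭ U↭ u) ⟩
        suc (∑ (members j) (λ u → 𝟙 (c ∈? L u) + avail U′ u))   ≡⟨ cong suc (∑-+ (members j) _ _) ⟩
        suc (deg j c + ∑ (members j) (avail U′))                ∎))
        where
        regroup : ∀ a b z → a + (a * b + suc z) ≡ suc (a * suc b + z)
        regroup = solve-∀
      -- A colour on more than `m` but not all vertices of part `i` shows that the part is large.
      large : 1 ≤ ex i
      large = +-cancelˡ-≤ (suc m) 1 (ex i) (begin
        suc m + 1            ≡⟨ +-comm (suc m) 1 ⟩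
        suc (suc m)          ≤⟨ s≤s m<deg ⟩
        suc (deg i c)        ≤⟨ deg< i∈ c∈ ⟩
        p i                  ≡⟨ p≡ i ⟩
        suc m + ex i         ∎)
      few′ : ∑ Ts′ ex + suc (length Z) ≤ m
      few′ = begin
        ∑ Ts′ ex + suc (length Z)        ≡⟨ +-suc _ _ ⟩
        suc (∑ Ts′ ex + length Z)        ≤⟨ +-monoˡ-≤ (∑ Ts′ ex + length Z) large ⟩
        ex i + (∑ Ts′ ex + length Z)     ≡⟨ +-assoc (ex i) _ _ ⟨
        (ex i + ∑ Ts′ ex) + length Z     ≡⟨ cong (_+ length Z) (∑-↭ Ts↭ ex) ⟨
        ∑ Ts ex + length Z               ≤⟨ few ⟩
        m                                ∎

  -- Deleting a part with a common colour costs every other list at most one colour and lowers the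
  -- number of parts by one, so the list bound survives. If no colour is common, the initial state
  -- has `Z` empty and `richPart` follows by summing `rich`.
  remove-common : ∀ n {Ts U} → length Ts < n → Unique Ts → Unique U → (∀ {v} → proj₁ v ∈ Ts → length Ts ≤ avail U v) →
                  ∑ Ts ex ≤ m → Colouring (Active Ts []) U
  remove-common (suc n) {Ts} {U} fuel Ts! U! rich few
    with any? (λ i → any? (λ c → all? (λ v → c ∈? L v) (members i)) U) Ts
  ... | no none = split-large (suc n) fuel record
    { Ts! = Ts! ; U! = U! ; Z! = [] ; Z∉Ts = λ ()
    ; deg< = λ {i} {c} i∈ c∈ → subst (deg i c <_) (length-members i)
        (¬All⇒count<length (λ v → c ∈? L v) λ all → none (lose i∈ (lose c∈ all)))
    ; rich = rich
    ; richPart = λ {i} i∈ → begin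
        p i * length Ts + 0                    ≡⟨ +-identityʳ _ ⟩
        p i * length Ts                        ≡⟨ cong (_* length Ts) (length-members i) ⟨
        length (members i) * length Ts         ≡⟨ ∑-const (members i) _ ⟨
        ∑ (members i) (λ _ → length Ts)        ≤⟨ ∑-mono (members i) (λ v∈ → rich (subst (_∈ Ts) (sym (members-part v∈)) i∈)) ⟩
        ∑ (members i) (avail U)                ∎
    ; richZ = λ ()
    ; few = subst (_≤ m) (sym (+-identityʳ _)) few
    }
    where open ≤-Reasoning
  ... | yes some
    with i , i∈ , some′ ← find some
    with c , c∈ , common ← find some′
    with Ts′ , Ts↭ ← extract i∈
    with U′ , U↭ ← extract c∈ =
    paint (λ v → proj₁ v Fin.≟ i) U! U↭ (λ { {u} refl → refl , All.lookup common (∈-members u) })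
          (λ { (inj₁ u∈) u≢i → inj₁ (∈-↭-≢ Ts↭ u∈ u≢i) })
          (remove-common n (s≤s⁻¹ (subst (_< suc n) len fuel)) (proj₂ (Unique-uncons Ts↭ Ts!)) (proj₂ (Unique-uncons U↭ U!))
            (λ {u} u∈ → avail-drop U↭ u (subst (_≤ avail U u) len (rich (↭-tail⊆ Ts↭ u∈))))
            (≤-trans (≤-trans (m≤n+m _ (ex i)) (≤-reflexive (sym (∑-↭ Ts↭ ex)))) few))
    where len = ↭-length Ts↭

  listColourable : (∀ v → length (L v) ≡ k × Unique (L v)) → ∑ (allFin k) ex ≤ m →
                   LColourable (CompleteMultipartite (suc m) k p) L
  listColourable isL few = colour , proj₂ ∘ allowed ∘ active , λ e (len , e! , ¬one) (c , mono) →
      ¬one (proper e! len (All.universal active e) mono)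
    where
    U : List ℕ
    -- `U` contains every colour of every list, so `avail U v` is at least `k`, the number of parts.
    U = deduplicate _≟_ (concatMap L (vertices (allFin k)))
    active : ∀ v → Active (allFin k) [] v
    active v = inj₁ (∈-allFin (proj₁ v))
    rich : ∀ v → length (allFin k) ≤ avail U v
    rich v = begin
      length (allFin k)    ≡⟨ length-tabulate id ⟩
      k                    ≡⟨ proj₁ (isL v) ⟨
      length (L v)         ≤⟨ unique-length≤count (_∈? L v) (proj₂ (isL v)) (λ c∈ →
                                ∈-deduplicate⁺ _≟_ (∈-concatMap⁺ L (lose (∈-vertices⁺ (∈-allFin (proj₁ v))) c∈)) , c∈) ⟩
      avail U v            ∎
      where open ≤-Reasoning
    open Colouring (remove-common (suc (length (allFin k))) ≤-refl (allFin⁺ k) (deduplicate-! _≟_ (concatMap L (vertices (allFin k)))) (λ {v} _ → rich v) few)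

-- Lower bound

module _ {k m : ℕ} (p : Fin k → ℕ) (1≤m : 1 ≤ m) (p≥ : ∀ i → suc m ≤ p i) (f : Σ (Fin k) (Fin ∘ p) → ℕ)
         (f-proper : Proper (CompleteMultipartite (suc m) k p) f) where

  open Parts p

  class : List (Fin k) → ℕ → List Vertex
  class Ts c = filter (λ v → f v ≟ c) (vertices Ts)

  ∈-class⁻ : ∀ Ts {c v} → v ∈ class Ts c → v ∈ vertices Ts × f v ≡ c
  ∈-class⁻ Ts {c} = ∈-filter⁻ (λ v → f v ≟ c) {xs = vertices Ts}

  -- Two vertices of the class in different parts, filled up from the class to `m + 1` vertices,
  -- would form a monochromatic edge.
  big-class-in-one-part : ∀ {xs c} → Unique xs → All (λ v → f v ≡ c) xs → m < length xs →
                          ∃ λ x → x ∈ xs × (∀ {v} → v ∈ xs → proj₁ v ≡ proj₁ x)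
  big-class-in-one-part {x ∷ xs} {c} xs! mono big with all? (λ v → proj₁ v Fin.≟ proj₁ x) xs
  ... | yes same = x , here refl , λ { (here refl) → refl ; (there v∈) → All.lookup same v∈ }
  ... | no ¬same
    with y , y∈ , y≢ ← find (¬All⇒Any¬ (λ v → proj₁ v Fin.≟ proj₁ x) xs ¬same)
    with zs , p ← extract y∈ =
    contradiction (c , All.take⁺ (suc m) (All.tabulate λ v∈ → All.lookup mono (∈-resp-↭ (↭-sym p′) v∈)))
                  (f-proper edge (edge-length , take⁺ (suc m) (Unique-resp-↭ p′ xs!) , λ (i , one) → split 1≤m one))
    where
    p′ : x ∷ xs ↭ x ∷ y ∷ zs
    p′ = prep x p
    -- With `x` and `y` placed first, both survive the truncation because `m` is at least 1.
    edge = take (suc m) (x ∷ y ∷ zs)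
    edge-length : length edge ≡ suc m
    edge-length = trans (length-take (suc m) (x ∷ y ∷ zs)) (m≤n⇒m⊓n≡m (subst (m <_) (↭-length p′) big))
    split : ∀ {n i} → 1 ≤ n → ¬ All (λ v → proj₁ v ≡ i) (take (suc n) (x ∷ y ∷ zs))
    split (s≤s _) (x≡i ∷ y≡i ∷ _) = y≢ (trans y≡i (sym x≡i))

  -- Induction on the number of colours, with `n` as fuel: a class of more than `m` vertices removes
  -- one part and one colour; if there is none, the vertices are counted by part and by colour.
  parts≤colours : ∀ n {Ts U} → length U < n → Unique Ts → (∀ {v} → proj₁ v ∈ Ts → f v ∈ U) → length Ts ≤ length U
  parts≤colours (suc n) {Ts} {U} fuel Ts! f∈ with any? (λ c → m <? length (class Ts c)) U
  ... | no none = *-cancelʳ-≤ (length Ts) (length U) (suc m) (begin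
    length Ts * suc m                                      ≡⟨ ∑-const Ts (suc m) ⟨
    ∑ Ts (λ _ → suc m)                                     ≤⟨ ∑-mono Ts (λ {i} _ → subst (suc m ≤_) (sym (length-members i)) (p≥ i)) ⟩
    ∑ Ts (length ∘ members)                                ≡⟨ ∑-cong Ts (λ {i} _ → sym (trans (∑-const (members i) 1) (*-identityʳ _))) ⟩
    ∑ Ts (λ i → ∑ (members i) λ _ → 1)                     ≡⟨ ∑-concatMap Ts members _ ⟨
    ∑ (vertices Ts) (λ _ → 1)                              ≤⟨ ∑-mono (vertices Ts) coloured ⟩
    ∑ (vertices Ts) (λ v → ∑ U λ c → 𝟙 (f v ≟ c))          ≡⟨ ∑-swap (vertices Ts) U _ ⟩
    ∑ U (λ c → ∑ (vertices Ts) λ v → 𝟙 (f v ≟ c))          ≤⟨ ∑-mono U small ⟩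
    ∑ U (λ _ → suc m)                                      ≡⟨ ∑-const U (suc m) ⟩
    length U * suc m                                       ∎)
    where
    open ≤-Reasoning
    coloured : ∀ {v} → v ∈ vertices Ts → 1 ≤ ∑ U (λ c → 𝟙 (f v ≟ c))
    coloured {v} v∈ = subst (_≤ ∑ U (λ c → 𝟙 (f v ≟ c))) (𝟙-yes (f v ≟ f v) refl) (∑-term (f∈ (∈-vertices⁻ Ts v∈)) _)
    small : ∀ {c} → c ∈ U → ∑ (vertices Ts) (λ v → 𝟙 (f v ≟ c)) ≤ suc m
    -- The class has at most `m` vertices; the weaker bound `suc m` lets the common factor cancel.
    small {c} c∈ rewrite count≡length-filter (λ v → f v ≟ c) (vertices Ts) = m≤n⇒m≤1+n (≮⇒≥ λ lt → none (lose c∈ lt))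
  ... | yes some
    with c , c∈ , big ← find some
    with x , x∈ , same ← big-class-in-one-part (filter⁺ (λ v → f v ≟ c) (vertices-! Ts!))
                           (All.tabulate (proj₂ ∘ ∈-class⁻ Ts)) big
    with Ts′ , Ts↭ ← extract (∈-vertices⁻ Ts (proj₁ (∈-class⁻ Ts x∈)))
    with U′ , U↭ ← extract c∈ =
    subst₂ _≤_ (sym (↭-length Ts↭)) (sym (↭-length U↭))
      (s≤s (parts≤colours n (s≤s⁻¹ (subst (_< suc n) (↭-length U↭) fuel)) Ts′! f∈′))
    where
    Ts′! = proj₂ (Unique-uncons Ts↭ Ts!)
    f∈′ : ∀ {v} → proj₁ v ∈ Ts′ → f v ∈ U′
    -- A remaining vertex of colour `c` would belong to the class, hence to the deleted part of `x`.
    f∈′ {v} v∈ = ∈-↭-≢ U↭ (f∈ v∈Ts) λ fv≡c → proj₁ (Unique-uncons Ts↭ Ts!)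
      (subst (_∈ Ts′) (same (∈-filter⁺ (λ v → f v ≟ c) (∈-vertices⁺ v∈Ts) fv≡c)) v∈)
      where v∈Ts = ↭-tail⊆ Ts↭ v∈

-- With all lists equal to `upTo q`, choosability becomes ordinary colourability with `q` colours.
¬choosable : ∀ {k m} (p : Fin k → ℕ) → 1 ≤ m → (∀ i → suc m ≤ p i) →
             ∀ q → q < k → ¬ Choosable (CompleteMultipartite (suc m) k p) q
¬choosable {k} p 1≤m p≥ q q<k choosable
  with f , f∈ , f-proper ← choosable (λ _ → upTo q) (λ _ → length-upTo q , upTo⁺ q) =
  <⇒≱ q<k (subst₂ _≤_ (length-tabulate id) (length-upTo q)
    (parts≤colours p 1≤m p≥ f f-proper (suc (length (upTo q))) ≤-refl (allFin⁺ k) (λ {v} _ → f∈ v)))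

-- Both bounds for the prescribed part sizes

theorem4p7 : (r k : ℕ) → 2 ≤ r → r ∸ 1 ≤ k → ListChromaticNumberIs (K r k) k
theorem4p7 (suc m) k (s≤s 1≤m) _ =
    (λ L isL → Choose.listColourable m excess (partSizes (suc m) k) sizes (λ i → 𝟙≤1 (toℕ i <? m)) L isL few)
  , ¬choosable (partSizes (suc m) k) 1≤m λ i → subst (suc m ≤_) (sym (sizes i)) (m≤m+n (suc m) (excess i))
  where
  excess : Fin k → ℕ
  excess i = 𝟙 (toℕ i <? m)
  sizes : ∀ i → partSizes (suc m) k i ≡ suc m + excess i
  sizes i with toℕ i <? m
  ... | yes _ = cong suc (+-comm 1 m)
  ... | no _  = sym (+-identityʳ (suc m))
  large : List (Fin k)
  large = filter (λ i → toℕ i <? m) (allFin k)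
  few : ∑ (allFin k) excess ≤ m
  few = begin
    ∑ (allFin k) excess        ≡⟨ count≡length-filter (λ i → toℕ i <? m) (allFin k) ⟩
    length large               ≡⟨ length-map toℕ large ⟨
    -- Large parts are those with index below `m`, so their indices embed in `upTo m`.
    length (map toℕ large)     ≤⟨ unique-⊆-length (map⁺ Fin.toℕ-injective (filter⁺ (λ i → toℕ i <? m) (allFin⁺ k))) below ⟩
    length (upTo m)            ≡⟨ length-upTo m ⟩
    m                          ∎
    where
    open ≤-Reasoning
    below : ∀ {n} → n ∈ map toℕ large → n ∈ upTo m
    below n∈ with i , i∈ , refl ← ∈-map⁻ toℕ n∈ = ∈-upTo⁺ (proj₂ (∈-filter⁻ (λ i → toℕ i <? m) {xs = allFin k} i∈))
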